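{- Let $G(V, E, w)$ be a directed social network. Then $\mathrm{IE}\left(1-\frac{\sqrt{2}}{2},\, 2-\sqrt{2}\right)$ approximates the maximum revenue of $G$ within a factor of $\sqrt{2}(2-\sqrt{2})(\sqrt{2}-1) \approx 0.343$; that is, its expected revenue is at least $\sqrt{2}(2-\sqrt{2})(\sqrt{2}-1)\cdot R_{\max}(G)$.
   Context: A directed social network $G(V,E,w)$ on a finite set $V$ of $n$ buyers has real weights $w_{ij} \geq 0$ for ordered pairs of distinct buyers, with $w_{ij}>0$ exactly when $(i,j)\in E$; for directed networks there are no loops, i.e., $w_{ii}=0$. Marketing strategies (Uniform Additive Model). A marketing strategy $(\vec{\pi},\vec{p})$ consists of a permutation $\vec{\pi}$ of $V$ ($\pi_i$ is the position of buyer $i$) and a vector $\vec{p}$ of pricing probabilities $p_i \in [1/2,1]$. Its expected revenue is $$R(\vec{\pi},\vec{p}) = \sum_{i\in V} p_i(1-p_i)\sum_{j:\pi_j<\pi_i} p_j w_{ji},$$ and $R_{\max}(G) = \max_{(\vec{\pi},\vec{p})} R(\vec{\pi},\vec{p})$ is the maximum revenue of $G$. IE strategies. For $A \subseteq V$ and $p \in [1/2,1)$, $\mathrm{IE}(A,p)$ gives the product for free to the buyers in $A$ and then approaches the buyers in $V\setminus A$ in uniformly random order with pricing probability $p$. Its expected revenue (over the random order) is $$R_{\mathrm{IE}}(A,p) = p(1-p)\sum_{i\in V\setminus A}\Big(\sum_{j\in A} w_{ji} + \sum_{j\in V\setminus A,\ j\neq i} \frac{p\,w_{ji}}{2}\Big).$$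 For $q\in[0,1]$, $\mathrm{IE}(q,p)$ denotes the strategy $\mathrm{IE}(A,p)$ where $A$ is a random set containing each buyer independently with probability $q$; its expected revenue is $\mathbb{E}_A[R_{\mathrm{IE}}(A,p)]$. -}

module Defs where

open import Algebra.Bundles.Raw using (RawMonoid)
import Algebra.Definitions.RawMonoid as RawMonoidDefs
open import Data.Bool.Base using (if_then_else_)
open import Data.Fin.Base as Fin using (Fin)
import Data.Fin.Properties as Fin
open import Data.Fin.Permutation using (Permutation′; _⟨$⟩ʳ_)
open import Data.Fin.Subset using (Subset; inside; outside)
open import Data.Fin.Subset.Properties using (_∈?_)
open import Data.Integer.Base as ℤ using (+_; +[1+_])
import Data.Integer.Properties as ℤ
open import Data.Nat.Base as ℕ using (ℕ; zero; suc)
import Data.Nat.Properties as ℕ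
open import Data.Product.Base using (_×_; _,_; ∃-syntax; proj₁; proj₂)
open import Data.Rational.Base as ℚ using (ℚ; 0ℚ; 1ℚ; ½; ∣_∣; Positive)
import Data.Rational.Properties as ℚ
import Data.Rational.Unnormalised.Base as ℚᵘ
import Data.Rational.Unnormalised.Properties as ℚᵘ
open import Data.Rational.Solver using (module +-*-Solver)
open import Data.Vec.Base using ([]; _∷_)
open import Data.Vec.Functional using (Vector)
open import Function.Bundles using (_⇔_)
open import Level using (0ℓ)
open import Relation.Binary.Core using (Rel)
open import Relation.Binary.PropositionalEquality
  using (_≡_; refl; sym; cong; subst; module ≡-Reasoning)
open import Relation.Nullary.Decidable.Core using (does; ¬?; _×-dec_)
open import Relation.Unary using (Pred; Decidable)

-- Real numbers: Cauchy sequences of rationals (with a modulus, since ∃ is Σ),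
-- considered up to the equality _≃_.

IsCauchy : (ℕ → ℚ) → Set
IsCauchy x = ∀ ε → 0ℚ ℚ.< ε →
  ∃[ N ] (∀ m n → N ℕ.≤ m → N ℕ.≤ n → ∣ x m ℚ.- x n ∣ ℚ.≤ ε)

record ℝ : Set where
  constructor mkℝ
  field
    seq    : ℕ → ℚ
    cauchy : IsCauchy seq

open ℝ public

infix 4 _≃_ _≤_ _<_

_≃_ : Rel ℝ 0ℓ
x ≃ y = ∀ ε → 0ℚ ℚ.< ε → ∃[ N ] (∀ n → N ℕ.≤ n → ∣ seq x n ℚ.- seq y n ∣ ℚ.≤ ε)

_≤_ : Rel ℝ 0ℓ
x ≤ y = ∀ ε → 0ℚ ℚ.< ε → ∃[ N ] (∀ n → N ℕ.≤ n → seq x n ℚ.≤ seq y n ℚ.+ ε)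

_<_ : Rel ℝ 0ℓ
x < y = ∃[ ε ] (0ℚ ℚ.< ε × ∃[ N ] (∀ n → N ℕ.≤ n → seq x n ℚ.+ ε ℚ.≤ seq y n))

abstract

  half-positive : ∀ {ε} → 0ℚ ℚ.< ε → 0ℚ ℚ.< ½ ℚ.* ε
  half-positive 0<ε = ℚ.*-monoʳ-<-pos ½ 0<ε

  half+half : ∀ ε → ½ ℚ.* ε ℚ.+ ½ ℚ.* ε ≡ ε
  half+half = solve 1 (λ e → con ½ :* e :+ con ½ :* e := e) refl
    where open +-*-Solver

  ∣p∣∣q∣-mono : ∀ {p q r s} → ∣ p ∣ ℚ.≤ r → ∣ q ∣ ℚ.≤ s → ∣ p ℚ.* q ∣ ℚ.≤ r ℚ.* s
  ∣p∣∣q∣-mono {p} {q} {r} {s} p≤r q≤s = begin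
    ∣ p ℚ.* q ∣      ≡⟨ ℚ.∣p*q∣≡∣p∣*∣q∣ p q ⟩
    ∣ p ∣ ℚ.* ∣ q ∣  ≤⟨ ℚ.*-monoʳ-≤-nonNeg ∣ q ∣ {{ℚ.∣-∣-nonNeg q}} p≤r ⟩
    r ℚ.* ∣ q ∣      ≤⟨ ℚ.*-monoˡ-≤-nonNeg r
                          {{ℚ.nonNegative (ℚ.≤-trans (ℚ.0≤∣p∣ p) p≤r)}} q≤s ⟩
    r ℚ.* s          ∎
    where open ℚ.≤-Reasoning

  const-cauchy : ∀ q → IsCauchy (λ _ → q)
  const-cauchy q ε 0<ε = 0 , λ _ _ _ _ → begin
    ∣ q ℚ.- q ∣  ≡⟨ cong ∣_∣ (ℚ.+-inverseʳ q) ⟩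
    0ℚ           ≤⟨ ℚ.<⇒≤ 0<ε ⟩
    ε            ∎
    where open ℚ.≤-Reasoning

  +-cauchy : ∀ {x y} → IsCauchy x → IsCauchy y → IsCauchy (λ n → x n ℚ.+ y n)
  +-cauchy {x} {y} cx cy ε 0<ε
    with cx (½ ℚ.* ε) (half-positive 0<ε) | cy (½ ℚ.* ε) (half-positive 0<ε)
  ... | N₁ , h₁ | N₂ , h₂ = N₁ ℕ.⊔ N₂ , λ m n m≥ n≥ → begin
    ∣ (x m ℚ.+ y m) ℚ.- (x n ℚ.+ y n) ∣
      ≡⟨ cong ∣_∣ (solve 4 (λ a b c d → (a :+ b) :- (c :+ d) := (a :- c) :+ (b :- d))
                     refl (x m) (y m) (x n) (y n)) ⟩
    ∣ (x m ℚ.- x n) ℚ.+ (y m ℚ.- y n) ∣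
      ≤⟨ ℚ.∣p+q∣≤∣p∣+∣q∣ (x m ℚ.- x n) (y m ℚ.- y n) ⟩
    ∣ x m ℚ.- x n ∣ ℚ.+ ∣ y m ℚ.- y n ∣
      ≤⟨ ℚ.+-mono-≤
           (h₁ m n (ℕ.m⊔n≤o⇒m≤o N₁ N₂ m≥) (ℕ.m⊔n≤o⇒m≤o N₁ N₂ n≥))
           (h₂ m n (ℕ.m⊔n≤o⇒n≤o N₁ N₂ m≥) (ℕ.m⊔n≤o⇒n≤o N₁ N₂ n≥)) ⟩
    ½ ℚ.* ε ℚ.+ ½ ℚ.* ε
      ≡⟨ half+half ε ⟩
    ε ∎
    where
    open ℚ.≤-Reasoning
    open +-*-Solver

  neg-cauchy : ∀ {x} → IsCauchy x → IsCauchy (λ n → ℚ.- x n)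
  neg-cauchy {x} cx ε 0<ε with cx ε 0<ε
  ... | N , h = N , λ m n m≥ n≥ → begin
    ∣ ℚ.- x m ℚ.- ℚ.- x n ∣
      ≡⟨ cong ∣_∣ (solve 2 (λ a b → :- a :- :- b := :- (a :- b)) refl (x m) (x n)) ⟩
    ∣ ℚ.- (x m ℚ.- x n) ∣
      ≡⟨ ℚ.∣-p∣≡∣p∣ (x m ℚ.- x n) ⟩
    ∣ x m ℚ.- x n ∣
      ≤⟨ h m n m≥ n≥ ⟩
    ε ∎
    where
    open ℚ.≤-Reasoning
    open +-*-Solver

  eventually-bounded : ∀ {x} → IsCauchy x →
    ∃[ B ] (Positive B × ∃[ N ] (∀ n → N ℕ.≤ n → ∣ x n ∣ ℚ.≤ B))
  eventually-bounded {x} cx with cx 1ℚ (ℚ.positive⁻¹ 1ℚ)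
  ... | N , h =
    1ℚ ℚ.+ ∣ x N ∣ ,
    ℚ.pos+nonNeg⇒pos 1ℚ ∣ x N ∣ {{ℚ.∣-∣-nonNeg (x N)}} ,
    N , λ n n≥ → begin
      ∣ x n ∣                      ≡⟨ cong ∣_∣ (solve 2 (λ a b → a := (a :- b) :+ b)
                                                 refl (x n) (x N)) ⟩
      ∣ (x n ℚ.- x N) ℚ.+ x N ∣    ≤⟨ ℚ.∣p+q∣≤∣p∣+∣q∣ (x n ℚ.- x N) (x N) ⟩
      ∣ x n ℚ.- x N ∣ ℚ.+ ∣ x N ∣  ≤⟨ ℚ.+-monoˡ-≤ ∣ x N ∣ (h n N n≥ ℕ.≤-refl) ⟩
      1ℚ ℚ.+ ∣ x N ∣               ∎
    where
    open ℚ.≤-Reasoning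
    open +-*-Solver

  divide : ∀ B → Positive B → ∀ ε → 0ℚ ℚ.< ε → ∃[ δ ] (0ℚ ℚ.< δ × B ℚ.* δ ≡ ε)
  divide B B>0 ε 0<ε = B⁻¹ ℚ.* ε , 0<δ , Bδ≡ε
    where
    B≢0 : ℚ.NonZero B
    B≢0 = ℚ.pos⇒nonZero B {{B>0}}

    B⁻¹ : ℚ
    B⁻¹ = ℚ.1/_ B {{B≢0}}

    0<δ : 0ℚ ℚ.< B⁻¹ ℚ.* ε
    0<δ = ℚ.positive⁻¹ (B⁻¹ ℚ.* ε)
      {{ℚ.pos*pos⇒pos B⁻¹ {{ℚ.1/pos⇒pos B {{B>0}}}} ε {{ℚ.positive 0<ε}}}}

    Bδ≡ε : B ℚ.* (B⁻¹ ℚ.* ε) ≡ ε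
    Bδ≡ε = begin
      B ℚ.* (B⁻¹ ℚ.* ε)  ≡⟨ ℚ.*-assoc B B⁻¹ ε ⟨
      B ℚ.* B⁻¹ ℚ.* ε    ≡⟨ cong (ℚ._* ε) (ℚ.*-inverseʳ B {{B≢0}}) ⟩
      1ℚ ℚ.* ε           ≡⟨ ℚ.*-identityˡ ε ⟩
      ε                  ∎
      where open ≡-Reasoning

  product-difference : ∀ a b c d →
    a ℚ.* b ℚ.- c ℚ.* d ≡ a ℚ.* (b ℚ.- d) ℚ.+ d ℚ.* (a ℚ.- c)
  product-difference =
    solve 4 (λ a b c d → a :* b :- c :* d := a :* (b :- d) :+ d :* (a :- c)) refl
    where open +-*-Solver

  product-close : ∀ a b c d {r s δ} → ∣ a ∣ ℚ.≤ r → ∣ d ∣ ℚ.≤ s →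
    ∣ a ℚ.- c ∣ ℚ.≤ δ → ∣ b ℚ.- d ∣ ℚ.≤ δ →
    ∣ a ℚ.* b ℚ.- c ℚ.* d ∣ ℚ.≤ (r ℚ.+ s) ℚ.* δ
  product-close a b c d {r} {s} {δ} a≤ d≤ a-c≤ b-d≤ = begin
    ∣ a ℚ.* b ℚ.- c ℚ.* d ∣
      ≡⟨ cong ∣_∣ (product-difference a b c d) ⟩
    ∣ a ℚ.* (b ℚ.- d) ℚ.+ d ℚ.* (a ℚ.- c) ∣
      ≤⟨ ℚ.∣p+q∣≤∣p∣+∣q∣ (a ℚ.* (b ℚ.- d)) (d ℚ.* (a ℚ.- c)) ⟩
    ∣ a ℚ.* (b ℚ.- d) ∣ ℚ.+ ∣ d ℚ.* (a ℚ.- c) ∣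
      ≤⟨ ℚ.+-mono-≤ (∣p∣∣q∣-mono {a} {b ℚ.- d} a≤ b-d≤)
                    (∣p∣∣q∣-mono {d} {a ℚ.- c} d≤ a-c≤) ⟩
    r ℚ.* δ ℚ.+ s ℚ.* δ
      ≡⟨ ℚ.*-distribʳ-+ δ r s ⟨
    (r ℚ.+ s) ℚ.* δ ∎
    where open ℚ.≤-Reasoning

  *-cauchy : ∀ {x y} → IsCauchy x → IsCauchy y → IsCauchy (λ n → x n ℚ.* y n)
  *-cauchy {x} {y} cx cy ε 0<ε = bounded (eventually-bounded cx) (eventually-bounded cy)
    where
    EventuallyBounded : (ℕ → ℚ) → Set
    EventuallyBounded z = ∃[ B ] (Positive B × ∃[ N ] (∀ n → N ℕ.≤ n → ∣ z n ∣ ℚ.≤ B))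

    EventuallyWithin : ℚ → (ℕ → ℚ) → Set
    EventuallyWithin δ z = ∃[ N ] (∀ m n → N ℕ.≤ m → N ℕ.≤ n → ∣ z m ℚ.- z n ∣ ℚ.≤ δ)

    close : ∀ {r s δ} Nx Ny →
      (∀ n → Nx ℕ.≤ n → ∣ x n ∣ ℚ.≤ r) → (∀ n → Ny ℕ.≤ n → ∣ y n ∣ ℚ.≤ s) →
      (r ℚ.+ s) ℚ.* δ ≡ ε → EventuallyWithin δ x → EventuallyWithin δ y →
      EventuallyWithin ε (λ n → x n ℚ.* y n)
    close Nx Ny hx hy eq (N₁ , h₁) (N₂ , h₂) =
      (Nx ℕ.⊔ Ny) ℕ.⊔ (N₁ ℕ.⊔ N₂) , λ m n m≥ n≥ →
      let m≥x,y = ℕ.m⊔n≤o⇒m≤o (Nx ℕ.⊔ Ny) (N₁ ℕ.⊔ N₂) m≥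
          n≥x,y = ℕ.m⊔n≤o⇒m≤o (Nx ℕ.⊔ Ny) (N₁ ℕ.⊔ N₂) n≥
          m≥1,2 = ℕ.m⊔n≤o⇒n≤o (Nx ℕ.⊔ Ny) (N₁ ℕ.⊔ N₂) m≥
          n≥1,2 = ℕ.m⊔n≤o⇒n≤o (Nx ℕ.⊔ Ny) (N₁ ℕ.⊔ N₂) n≥
      in ℚ.≤-trans
           (product-close (x m) (y m) (x n) (y n)
             (hx m (ℕ.m⊔n≤o⇒m≤o Nx Ny m≥x,y))
             (hy n (ℕ.m⊔n≤o⇒n≤o Nx Ny n≥x,y))
             (h₁ m n (ℕ.m⊔n≤o⇒m≤o N₁ N₂ m≥1,2) (ℕ.m⊔n≤o⇒m≤o N₁ N₂ n≥1,2))
             (h₂ m n (ℕ.m⊔n≤o⇒n≤o N₁ N₂ m≥1,2) (ℕ.m⊔n≤o⇒n≤o N₁ N₂ n≥1,2)))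
           (ℚ.≤-reflexive eq)

    bounded : EventuallyBounded x → EventuallyBounded y →
      EventuallyWithin ε (λ n → x n ℚ.* y n)
    bounded (r , r>0 , Nx , hx) (s , s>0 , Ny , hy) =
      let δ , 0<δ , eq = divide (r ℚ.+ s) (ℚ.pos+pos⇒pos r {{r>0}} s {{s>0}}) ε 0<ε
      in close Nx Ny hx hy eq (cx δ 0<δ) (cy δ 0<δ)

infixl 7 _*_
infixl 6 _+_ _-_
infix  8 -_

fromℚ : ℚ → ℝ
fromℚ q = mkℝ (λ _ → q) (const-cauchy q)

0ℝ 1ℝ 2ℝ ½ℝ : ℝ
0ℝ = fromℚ 0ℚ
1ℝ = fromℚ 1ℚ
2ℝ = fromℚ (1ℚ ℚ.+ 1ℚ)
½ℝ = fromℚ ½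

_+_ _*_ : ℝ → ℝ → ℝ
x + y = mkℝ (λ n → seq x n ℚ.+ seq y n) (+-cauchy {seq x} {seq y} (cauchy x) (cauchy y))
x * y = mkℝ (λ n → seq x n ℚ.* seq y n) (*-cauchy {seq x} {seq y} (cauchy x) (cauchy y))

-_ : ℝ → ℝ
-_ x = mkℝ (λ n → ℚ.- seq x n) (neg-cauchy {seq x} (cauchy x))

_-_ : ℝ → ℝ → ℝ
_-_ x y = x + (- y)

-- √2 - 1 is the fixed point of the contraction y ↦ (1 - y²)/2 of [0, ½].

√2-1-seq : ℕ → ℚ
√2-1-seq zero    = 0ℚ
√2-1-seq (suc n) = ½ ℚ.* (1ℚ ℚ.- √2-1-seq n ℚ.* √2-1-seq n)

½^ : ℕ → ℚ
½^ zero    = 1ℚ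
½^ (suc n) = ½ ℚ.* ½^ n

abstract

  0≤½^ : ∀ n → 0ℚ ℚ.≤ ½^ n
  0≤½^ zero    = ℚ.nonNegative⁻¹ 1ℚ
  0≤½^ (suc n) = ℚ.*-monoˡ-≤-nonNeg ½ {0ℚ} {½^ n} (0≤½^ n)

  step-bounds : ∀ y → 0ℚ ℚ.≤ y → y ℚ.≤ ½ →
    0ℚ ℚ.≤ ½ ℚ.* (1ℚ ℚ.- y ℚ.* y) × ½ ℚ.* (1ℚ ℚ.- y ℚ.* y) ℚ.≤ ½
  step-bounds y 0≤y y≤½ = lower , upper
    where
    open ℚ.≤-Reasoning

    y²≤1 : y ℚ.* y ℚ.≤ 1ℚ
    y²≤1 = begin
      y ℚ.* y  ≤⟨ ℚ.*-monoˡ-≤-nonNeg y {{ℚ.nonNegative 0≤y}} {y} {½} y≤½ ⟩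
      y ℚ.* ½  ≤⟨ ℚ.*-monoʳ-≤-nonNeg ½ {y} {½} y≤½ ⟩
      ½ ℚ.* ½  ≤⟨ ℚ.≤ᵇ⇒≤ {½ ℚ.* ½} {1ℚ} _ ⟩
      1ℚ       ∎

    0≤y² : 0ℚ ℚ.≤ y ℚ.* y
    0≤y² = begin
      0ℚ       ≡⟨ ℚ.*-zeroʳ y ⟨
      y ℚ.* 0ℚ ≤⟨ ℚ.*-monoˡ-≤-nonNeg y {{ℚ.nonNegative 0≤y}} {0ℚ} {y} 0≤y ⟩
      y ℚ.* y  ∎

    lower : 0ℚ ℚ.≤ ½ ℚ.* (1ℚ ℚ.- y ℚ.* y)
    lower = begin
      ½ ℚ.* (1ℚ ℚ.- 1ℚ)       ≤⟨ ℚ.*-monoˡ-≤-nonNeg ½ {1ℚ ℚ.- 1ℚ} {1ℚ ℚ.- y ℚ.* y}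
                                   (ℚ.+-monoʳ-≤ 1ℚ (ℚ.neg-antimono-≤ y²≤1)) ⟩
      ½ ℚ.* (1ℚ ℚ.- y ℚ.* y)  ∎

    upper : ½ ℚ.* (1ℚ ℚ.- y ℚ.* y) ℚ.≤ ½
    upper = begin
      ½ ℚ.* (1ℚ ℚ.- y ℚ.* y)  ≤⟨ ℚ.*-monoˡ-≤-nonNeg ½ {1ℚ ℚ.- y ℚ.* y} {1ℚ ℚ.- 0ℚ}
                                   (ℚ.+-monoʳ-≤ 1ℚ (ℚ.neg-antimono-≤ 0≤y²)) ⟩
      ½ ℚ.* (1ℚ ℚ.- 0ℚ)       ∎

  √2-1-bounds : ∀ n → 0ℚ ℚ.≤ √2-1-seq n × √2-1-seq n ℚ.≤ ½
  √2-1-bounds zero    = ℚ.≤-refl , ℚ.nonNegative⁻¹ ½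
  √2-1-bounds (suc n) =
    step-bounds (√2-1-seq n) (proj₁ (√2-1-bounds n)) (proj₂ (√2-1-bounds n))

  step-difference : ∀ y z →
    ½ ℚ.* (1ℚ ℚ.- y ℚ.* y) ℚ.- ½ ℚ.* (1ℚ ℚ.- z ℚ.* z)
      ≡ ℚ.- ((½ ℚ.* (y ℚ.+ z)) ℚ.* (y ℚ.- z))
  step-difference = solve 2 (λ a b →
    con ½ :* (con 1ℚ :- a :* a) :- con ½ :* (con 1ℚ :- b :* b)
      := :- ((con ½ :* (a :+ b)) :* (a :- b))) refl
    where open +-*-Solver

  step-contracts : ∀ y z {δ} →
    0ℚ ℚ.≤ y × y ℚ.≤ ½ → 0ℚ ℚ.≤ z × z ℚ.≤ ½ → ∣ y ℚ.- z ∣ ℚ.≤ δ →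
    ∣ ½ ℚ.* (1ℚ ℚ.- y ℚ.* y) ℚ.- ½ ℚ.* (1ℚ ℚ.- z ℚ.* z) ∣ ℚ.≤ ½ ℚ.* δ
  step-contracts y z {δ} (0≤y , y≤½) (0≤z , z≤½) y-z≤ = begin
    ∣ ½ ℚ.* (1ℚ ℚ.- y ℚ.* y) ℚ.- ½ ℚ.* (1ℚ ℚ.- z ℚ.* z) ∣
      ≡⟨ cong ∣_∣ (step-difference y z) ⟩
    ∣ ℚ.- ((½ ℚ.* (y ℚ.+ z)) ℚ.* (y ℚ.- z)) ∣
      ≡⟨ ℚ.∣-p∣≡∣p∣ ((½ ℚ.* (y ℚ.+ z)) ℚ.* (y ℚ.- z)) ⟩
    ∣ (½ ℚ.* (y ℚ.+ z)) ℚ.* (y ℚ.- z) ∣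
      ≤⟨ ∣p∣∣q∣-mono {½ ℚ.* (y ℚ.+ z)} {y ℚ.- z} mean≤½ y-z≤ ⟩
    ½ ℚ.* δ ∎
    where
    open ℚ.≤-Reasoning

    0≤mean : 0ℚ ℚ.≤ ½ ℚ.* (y ℚ.+ z)
    0≤mean = ℚ.*-monoˡ-≤-nonNeg ½ {0ℚ ℚ.+ 0ℚ} {y ℚ.+ z} (ℚ.+-mono-≤ 0≤y 0≤z)

    mean≤½ : ∣ ½ ℚ.* (y ℚ.+ z) ∣ ℚ.≤ ½
    mean≤½ = begin
      ∣ ½ ℚ.* (y ℚ.+ z) ∣  ≡⟨ ℚ.0≤p⇒∣p∣≡p 0≤mean ⟩
      ½ ℚ.* (y ℚ.+ z)      ≤⟨ ℚ.*-monoˡ-≤-nonNeg ½ {y ℚ.+ z} {½ ℚ.+ ½} (ℚ.+-mono-≤ y≤½ z≤½) ⟩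
      ½ ℚ.* (½ ℚ.+ ½)      ∎

  √2-1-contracts : ∀ n k → ∣ √2-1-seq n ℚ.- √2-1-seq (n ℕ.+ k) ∣ ℚ.≤ ½^ n
  √2-1-contracts zero k = begin
    ∣ 0ℚ ℚ.- √2-1-seq k ∣  ≡⟨ cong ∣_∣ (ℚ.+-identityˡ (ℚ.- √2-1-seq k)) ⟩
    ∣ ℚ.- √2-1-seq k ∣     ≡⟨ ℚ.∣-p∣≡∣p∣ (√2-1-seq k) ⟩
    ∣ √2-1-seq k ∣         ≡⟨ ℚ.0≤p⇒∣p∣≡p (proj₁ (√2-1-bounds k)) ⟩
    √2-1-seq k             ≤⟨ proj₂ (√2-1-bounds k) ⟩
    ½                      ≤⟨ ℚ.≤ᵇ⇒≤ {½} {1ℚ} _ ⟩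
    1ℚ                     ∎
    where open ℚ.≤-Reasoning
  √2-1-contracts (suc n) k =
    step-contracts (√2-1-seq n) (√2-1-seq (n ℕ.+ k))
      (√2-1-bounds n) (√2-1-bounds (n ℕ.+ k)) (√2-1-contracts n k)

  ½^-anti : ∀ {m n} → m ℕ.≤ n → ½^ n ℚ.≤ ½^ m
  ½^-anti {zero} {zero}  ℕ.z≤n = ℚ.≤-refl
  ½^-anti {zero} {suc n} ℕ.z≤n = begin
    ½ ℚ.* ½^ n  ≤⟨ ℚ.*-monoˡ-≤-nonNeg ½ {½^ n} {1ℚ} (½^-anti {zero} {n} ℕ.z≤n) ⟩
    ½ ℚ.* 1ℚ    ≤⟨ ℚ.≤ᵇ⇒≤ {½ ℚ.* 1ℚ} {1ℚ} _ ⟩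
    1ℚ          ∎
    where open ℚ.≤-Reasoning
  ½^-anti {suc m} {suc n} (ℕ.s≤s m≤n) =
    ℚ.*-monoˡ-≤-nonNeg ½ {½^ n} {½^ m} (½^-anti m≤n)

  multiple : ℕ → ℚ
  multiple zero    = 0ℚ
  multiple (suc n) = 1ℚ ℚ.+ multiple n

  toℚᵘ-multiple : ∀ n → ℚ.toℚᵘ (multiple n) ℚᵘ.≃ ℚᵘ.mkℚᵘ (+ n) 0
  toℚᵘ-multiple zero    = ℚᵘ.≃-refl
  toℚᵘ-multiple (suc n) = ℚᵘ.≃-trans (ℚ.toℚᵘ-homo-+ 1ℚ (multiple n))
    (ℚᵘ.≃-trans (ℚᵘ.+-congʳ ℚᵘ.1ℚᵘ (toℚᵘ-multiple n))
      (ℚᵘ.*≡* (cong (ℤ._* + 1) (cong (λ i → + 1 ℤ.+ i) (ℤ.*-identityʳ (+ n))))))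

  archimedean : ∀ ε → 0ℚ ℚ.< ε → ∃[ n ] 1ℚ ℚ.≤ multiple n ℚ.* ε
  archimedean ε@(ℚ.mkℚ (+ zero) d-1 _) (ℚ.*<* (ℤ.+<+ ()))
  archimedean ε@(ℚ.mkℚ +[1+ a ] d-1 _) _ = suc d-1 , ℚ.toℚᵘ-cancel-≤ (begin
    ℚᵘ.1ℚᵘ                                             ≤⟨ ℚᵘ.*≤* (ℤ.+≤+ bound) ⟩
    ℚᵘ.mkℚᵘ +[1+ d-1 ] 0 ℚᵘ.* ℚᵘ.mkℚᵘ +[1+ a ] d-1     ≃⟨ ℚᵘ.*-congʳ (toℚᵘ-multiple (suc d-1)) ⟨
    ℚ.toℚᵘ (multiple (suc d-1)) ℚᵘ.* ℚ.toℚᵘ ε          ≃⟨ ℚ.toℚᵘ-homo-* (multiple (suc d-1)) ε ⟨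
    ℚ.toℚᵘ (multiple (suc d-1) ℚ.* ε)                  ∎)
    where
    open ℚᵘ.≤-Reasoning
    bound : 1 ℕ.* (1 ℕ.* suc d-1) ℕ.≤ suc d-1 ℕ.* suc a ℕ.* 1
    bound = ℕ.≤-trans (ℕ.≤-reflexive (cong (1 ℕ.*_) (ℕ.*-identityˡ (suc d-1))))
      (ℕ.≤-trans (ℕ.≤-reflexive (ℕ.*-identityˡ (suc d-1)))
        (ℕ.≤-trans (ℕ.m≤m*n (suc d-1) (suc a))
          (ℕ.≤-reflexive (sym (ℕ.*-identityʳ (suc d-1 ℕ.* suc a))))))

  ½^*multiple≤1 : ∀ n → ½^ n ℚ.* multiple n ℚ.≤ 1ℚ
  ½^*multiple≤1 zero    = ℚ.≤ᵇ⇒≤ _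
  ½^*multiple≤1 (suc n) = begin
    (½ ℚ.* ½^ n) ℚ.* (1ℚ ℚ.+ multiple n)
      ≡⟨ solve 2 (λ h m → (con ½ :* h) :* (con 1ℚ :+ m) := con ½ :* (h :+ h :* m))
           refl (½^ n) (multiple n) ⟩
    ½ ℚ.* (½^ n ℚ.+ ½^ n ℚ.* multiple n)
      ≤⟨ ℚ.*-monoˡ-≤-nonNeg ½ (ℚ.+-mono-≤ (½^-anti {0} {n} ℕ.z≤n) (½^*multiple≤1 n)) ⟩
    ½ ℚ.* (1ℚ ℚ.+ 1ℚ)
      ≡⟨⟩
    1ℚ ∎
    where
    open ℚ.≤-Reasoning
    open +-*-Solver

  ½^-small : ∀ ε → 0ℚ ℚ.< ε → ∃[ N ] ½^ N ℚ.≤ ε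
  ½^-small ε 0<ε with archimedean ε 0<ε
  ... | N , 1≤Nε = N , (begin
    ½^ N                          ≡⟨ ℚ.*-identityʳ (½^ N) ⟨
    ½^ N ℚ.* 1ℚ                   ≤⟨ ℚ.*-monoˡ-≤-nonNeg (½^ N) {{ℚ.nonNegative (0≤½^ N)}} 1≤Nε ⟩
    ½^ N ℚ.* (multiple N ℚ.* ε)   ≡⟨ ℚ.*-assoc (½^ N) (multiple N) ε ⟨
    (½^ N ℚ.* multiple N) ℚ.* ε   ≤⟨ ℚ.*-monoʳ-≤-nonNeg ε {{ℚ.nonNegative (ℚ.<⇒≤ 0<ε)}}
                                       (½^*multiple≤1 N) ⟩
    1ℚ ℚ.* ε                      ≡⟨ ℚ.*-identityˡ ε ⟩
    ε                             ∎)
    where open ℚ.≤-Reasoning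

  √2-1-close : ∀ {m n} → m ℕ.≤ n → ∣ √2-1-seq m ℚ.- √2-1-seq n ∣ ℚ.≤ ½^ m
  √2-1-close {m} {n} m≤n =
    subst (λ k → ∣ √2-1-seq m ℚ.- √2-1-seq k ∣ ℚ.≤ ½^ m) (ℕ.m+[n∸m]≡n m≤n)
      (√2-1-contracts m (n ℕ.∸ m))

  distance-via : ∀ a b c {δ} → ∣ c ℚ.- a ∣ ℚ.≤ ½ ℚ.* δ → ∣ c ℚ.- b ∣ ℚ.≤ ½ ℚ.* δ →
    ∣ a ℚ.- b ∣ ℚ.≤ δ
  distance-via a b c {δ} c-a≤ c-b≤ = begin
    ∣ a ℚ.- b ∣
      ≡⟨ cong ∣_∣ (solve 3 (λ a b c → a :- b := (c :- b) :- (c :- a)) refl a b c) ⟩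
    ∣ (c ℚ.- b) ℚ.- (c ℚ.- a) ∣
      ≤⟨ ℚ.∣p-q∣≤∣p∣+∣q∣ (c ℚ.- b) (c ℚ.- a) ⟩
    ∣ c ℚ.- b ∣ ℚ.+ ∣ c ℚ.- a ∣
      ≤⟨ ℚ.+-mono-≤ c-b≤ c-a≤ ⟩
    ½ ℚ.* δ ℚ.+ ½ ℚ.* δ
      ≡⟨ half+half δ ⟩
    δ ∎
    where
    open ℚ.≤-Reasoning
    open +-*-Solver

  √2-1-cauchy : IsCauchy √2-1-seq
  √2-1-cauchy ε 0<ε =
    let N , ½^N≤ = ½^-small (½ ℚ.* ε) (half-positive 0<ε)
    in N , λ m n m≥ n≥ → distance-via (√2-1-seq m) (√2-1-seq n) (√2-1-seq N)
         (ℚ.≤-trans (√2-1-close m≥) ½^N≤) (ℚ.≤-trans (√2-1-close n≥) ½^N≤)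

√2 : ℝ
√2 = 1ℝ + mkℝ √2-1-seq √2-1-cauchy

abstract

  0≤√2 : 0ℝ ≤ √2
  0≤√2 ε 0<ε = 0 , λ n _ →
    ℚ.+-mono-≤ (ℚ.+-mono-≤ (ℚ.nonNegative⁻¹ 1ℚ) (proj₁ (√2-1-bounds n))) (ℚ.<⇒≤ 0<ε)

  square-error : ∀ y {δ} → ∣ y ℚ.- ½ ℚ.* (1ℚ ℚ.- y ℚ.* y) ∣ ℚ.≤ ½ ℚ.* δ →
    ∣ (1ℚ ℚ.+ y) ℚ.* (1ℚ ℚ.+ y) ℚ.- (1ℚ ℚ.+ 1ℚ) ∣ ℚ.≤ δ
  square-error y {δ} y-y′≤ = begin
    ∣ (1ℚ ℚ.+ y) ℚ.* (1ℚ ℚ.+ y) ℚ.- (1ℚ ℚ.+ 1ℚ) ∣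
      ≡⟨ cong ∣_∣ (solve 1 (λ a →
           (con 1ℚ :+ a) :* (con 1ℚ :+ a) :- (con 1ℚ :+ con 1ℚ)
             := (a :- con ½ :* (con 1ℚ :- a :* a)) :+ (a :- con ½ :* (con 1ℚ :- a :* a)))
           refl y) ⟩
    ∣ (y ℚ.- y′) ℚ.+ (y ℚ.- y′) ∣
      ≤⟨ ℚ.∣p+q∣≤∣p∣+∣q∣ (y ℚ.- y′) (y ℚ.- y′) ⟩
    ∣ y ℚ.- y′ ∣ ℚ.+ ∣ y ℚ.- y′ ∣
      ≤⟨ ℚ.+-mono-≤ y-y′≤ y-y′≤ ⟩
    ½ ℚ.* δ ℚ.+ ½ ℚ.* δ
      ≡⟨ half+half δ ⟩
    δ ∎
    where
    open ℚ.≤-Reasoning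
    open +-*-Solver
    y′ : ℚ
    y′ = ½ ℚ.* (1ℚ ℚ.- y ℚ.* y)

  √2*√2≃2 : √2 * √2 ≃ 2ℝ
  √2*√2≃2 ε 0<ε =
    let N , ½^N≤ = ½^-small (½ ℚ.* ε) (half-positive 0<ε)
    in N , λ n n≥ → square-error (√2-1-seq n)
         (ℚ.≤-trans (√2-1-close (ℕ.n≤1+n n)) (ℚ.≤-trans (½^-anti n≥) ½^N≤))

+-0-rawMonoid *-1-rawMonoid : RawMonoid 0ℓ 0ℓ
+-0-rawMonoid = record { Carrier = ℝ ; _≈_ = _≃_ ; _∙_ = _+_ ; ε = 0ℝ }
*-1-rawMonoid = record { Carrier = ℝ ; _≈_ = _≃_ ; _∙_ = _*_ ; ε = 1ℝ }

open RawMonoidDefs +-0-rawMonoid public using () renaming (sum to ∑)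
open RawMonoidDefs *-1-rawMonoid public using () renaming (sum to ∏)

∑[_] : ∀ {n} {P : Pred (Fin n) 0ℓ} → Decidable P → Vector ℝ n → ℝ
∑[ P? ] f = ∑ (λ i → if does (P? i) then f i else 0ℝ)

∑⊆ : ∀ {n} → (Subset n → ℝ) → ℝ
∑⊆ {zero}  f = f []
∑⊆ {suc n} f = ∑⊆ (λ A → f (inside ∷ A)) + ∑⊆ (λ A → f (outside ∷ A))

record DirectedSocialNetwork (n : ℕ) : Set₁ where
  field
    _⟶_      : Rel (Fin n) 0ℓ
    w        : Fin n → Fin n → ℝ
    w-nonNeg : ∀ i j → 0ℝ ≤ w i j
    w-edge   : ∀ i j → (i ⟶ j) ⇔ (0ℝ < w i j)
    w-noLoop : ∀ i → w i i ≃ 0ℝ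

-- π ⟨$⟩ʳ i is the position at which buyer i is approached.
record MarketingStrategy (n : ℕ) : Set where
  field
    π   : Permutation′ n
    p   : Vector ℝ n
    ½≤p : ∀ i → ½ℝ ≤ p i
    p≤1 : ∀ i → p i ≤ 1ℝ

module _ {n : ℕ} (G : DirectedSocialNetwork n) where
  open DirectedSocialNetwork G

  revenue : MarketingStrategy n → ℝ
  revenue σ = ∑ λ i →
    p i * (1ℝ - p i) * ∑[ (λ j → (π ⟨$⟩ʳ j) Fin.<? (π ⟨$⟩ʳ i)) ] (λ j → p j * w j i)
    where open MarketingStrategy σ

  -- Classically such an M exists by compactness; constructively the maximum
  -- need not be attained, so bounds in terms of M alone could be vacuous.
  IsMaximumRevenue : ℝ → Set
  IsMaximumRevenue M = (∀ σ → revenue σ ≤ M) × (∃[ σ ] revenue σ ≃ M)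

  -- Already averaged over the random order of V ∖ A, in which j precedes i
  -- with probability ½.
  revenueIE : Subset n → ℝ → ℝ
  revenueIE A p = p * (1ℝ - p) * ∑[ (λ i → ¬? (i ∈? A)) ] λ i →
    ∑[ (λ j → j ∈? A) ] (λ j → w j i) +
    ∑[ (λ j → ¬? (j ∈? A) ×-dec ¬? (j Fin.≟ i)) ] (λ j → ½ℝ * (p * w j i))

  subsetProbability : ℝ → Subset n → ℝ
  subsetProbability q A = ∏ λ i → if does (i ∈? A) then q else 1ℝ - q

  expectedRevenueIE : ℝ → ℝ → ℝ
  expectedRevenueIE q p = ∑⊆ λ A → subsetProbability q A * revenueIE A p

{-# OPTIONS --safe #-}
-- In IE(q,p) an edge (j,i) contributes p(1-p)((1-q)q + (1-q)²p/2) times its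
-- weight on average; for q = 1 - √2/2 and p = 2 - √2 this is p(1-p)√2/4.  In any
-- strategy it contributes at most 1/4 of its weight, since pᵢ(1-pᵢ) ≤ 1/4 and
-- pⱼ ≤ 1.  The quotient of the two bounds is √2p(1-p).
module Submission where

open import Defs
open import Algebra.Bundles using (CommutativeRing)
open import Algebra.Structures using (IsCommutativeRing)
import Algebra.Properties.Semiring.Sum as SemiringSum
open import Data.Bool.Base using (Bool; true; false; if_then_else_; not; _∧_)
open import Data.Fin.Base as Fin using (Fin; zero; suc)
import Data.Fin.Properties as Fin
open import Data.Fin.Permutation using (_⟨$⟩ʳ_)
open import Data.Fin.Subset using (Subset; inside; outside)
open import Data.Fin.Subset.Properties using (_∈?_)
open import Data.Nat.Base as ℕ using (ℕ; zero; suc)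
import Data.Nat.Properties as ℕ
open import Data.Product.Base using (_×_; _,_; ∃-syntax; proj₁; proj₂)
open import Data.Rational.Base as ℚ using (ℚ; 0ℚ; 1ℚ; ½; ∣_∣)
import Data.Rational.Properties as ℚ
open import Data.Rational.Solver using (module +-*-Solver)
open import Data.Vec.Base using ([]; _∷_)
open import Data.Sum.Base using (inj₁; inj₂)
open import Level using (0ℓ)
open import Relation.Binary.Bundles using (Preorder)
import Relation.Binary.Reasoning.Preorder as PreorderReasoning
import Relation.Binary.Reasoning.Setoid as SetoidReasoning
open import Relation.Binary.PropositionalEquality as ≡ using (_≡_; _≢_; refl; cong; subst)
open import Relation.Nullary.Decidable.Core using (Dec; yes; no; does; ¬?; _×-dec_)
open import Relation.Nullary.Negation.Core using (contradiction)

open +-*-Solver using (solve; _:=_; _:+_; _:*_; _:-_; :-_; con)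

-- Eventual properties of sequences and inequalities between rationals.

Eventually : (ℕ → Set) → Set
Eventually P = ∃[ N ] (∀ n → N ℕ.≤ n → P n)

always : ∀ {P : ℕ → Set} → (∀ n → P n) → Eventually P
always h = 0 , λ n _ → h n

zipEventually : ∀ {P Q R : ℕ → Set} → (∀ n → P n → Q n → R n) →
  Eventually P → Eventually Q → Eventually R
zipEventually f (N₁ , h₁) (N₂ , h₂) = N₁ ℕ.⊔ N₂ , λ n n≥ →
  f n (h₁ n (ℕ.m⊔n≤o⇒m≤o N₁ N₂ n≥)) (h₂ n (ℕ.m⊔n≤o⇒n≤o N₁ N₂ n≥))

p≤p+ε : ∀ p {ε} → 0ℚ ℚ.< ε → p ℚ.≤ p ℚ.+ ε
p≤p+ε p {ε} 0<ε = begin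
  p         ≡⟨ ℚ.+-identityʳ p ⟨
  p ℚ.+ 0ℚ  ≤⟨ ℚ.+-monoʳ-≤ p (ℚ.<⇒≤ 0<ε) ⟩
  p ℚ.+ ε   ∎
  where open ℚ.≤-Reasoning

0≤q-p : ∀ {p q} → p ℚ.≤ q → 0ℚ ℚ.≤ q ℚ.- p
0≤q-p {p} {q} p≤q = begin
  0ℚ       ≡⟨ ℚ.+-inverseʳ p ⟨
  p ℚ.- p  ≤⟨ ℚ.+-monoˡ-≤ (ℚ.- p) p≤q ⟩
  q ℚ.- p  ∎
  where open ℚ.≤-Reasoning

0≤p*q : ∀ {p q} → 0ℚ ℚ.≤ p → 0ℚ ℚ.≤ q → 0ℚ ℚ.≤ p ℚ.* q
0≤p*q {p} {q} 0≤p 0≤q = begin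
  0ℚ        ≡⟨ ℚ.*-zeroʳ p ⟨
  p ℚ.* 0ℚ  ≤⟨ ℚ.*-monoˡ-≤-nonNeg p {{ℚ.nonNegative 0≤p}} 0≤q ⟩
  p ℚ.* q   ∎
  where open ℚ.≤-Reasoning

p≤∣p∣ : ∀ p → p ℚ.≤ ∣ p ∣
p≤∣p∣ p with ℚ.≤-total 0ℚ p
... | inj₁ 0≤p = ℚ.≤-reflexive (≡.sym (ℚ.0≤p⇒∣p∣≡p 0≤p))
... | inj₂ p≤0 = ℚ.≤-trans p≤0 (ℚ.0≤∣p∣ p)

0≤p*p : ∀ p → 0ℚ ℚ.≤ p ℚ.* p
0≤p*p p with ℚ.≤-total 0ℚ p
... | inj₁ 0≤p = 0≤p*q 0≤p 0≤p
... | inj₂ p≤0 = begin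
  0ℚ                         ≤⟨ 0≤p*q (0≤q-p p≤0) (0≤q-p p≤0) ⟩
  (0ℚ ℚ.- p) ℚ.* (0ℚ ℚ.- p)  ≡⟨ solve 1 (λ a → (con 0ℚ :- a) :* (con 0ℚ :- a) := a :* a) refl p ⟩
  p ℚ.* p                    ∎
  where open ℚ.≤-Reasoning

-- Equality and order of the reals.

-- The relations of Defs unfold to Π-types, from which Agda cannot recover the
-- two reals; as records they can be used with implicit arguments.

infix 4 _≈_ _≲_

record _≈_ (x y : ℝ) : Set where
  constructor ≃⇒≈
  field ≈⇒≃ : x ≃ y

record _≲_ (x y : ℝ) : Set where
  constructor ≤⇒≲
  field ≲⇒≤ : x ≤ y

open _≲_


abstract

  -- The operations of `ℝ` act term by term, so every ring identity of the rationals passes to the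
  -- reals this way. Facts that hold only in the limit, such as the value of `√2 * √2`, do not.
  pointwise-≈ : ∀ {x y} → (∀ n → seq x n ≡ seq y n) → x ≈ y
  pointwise-≈ {x} {y} h = ≃⇒≈ λ ε 0<ε → always λ n → begin
    ∣ seq x n ℚ.- seq y n ∣  ≡⟨ cong (λ p → ∣ p ℚ.- seq y n ∣) (h n) ⟩
    ∣ seq y n ℚ.- seq y n ∣  ≡⟨ cong ∣_∣ (ℚ.+-inverseʳ (seq y n)) ⟩
    0ℚ                       ≤⟨ ℚ.<⇒≤ 0<ε ⟩
    ε                        ∎
    where open ℚ.≤-Reasoning

  ≈-sym : ∀ {x y} → x ≈ y → y ≈ x
  ≈-sym {x} {y} (≃⇒≈ x≃y) = ≃⇒≈ λ ε 0<ε → let N , h = x≃y ε 0<ε in N , λ n n≥ →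
    subst (ℚ._≤ ε)
      (≡.trans (≡.sym (ℚ.∣-p∣≡∣p∣ (seq x n ℚ.- seq y n)))
        (cong ∣_∣ (solve 2 (λ a b → :- (a :- b) := b :- a) refl (seq x n) (seq y n))))
      (h n n≥)

  private
    ∣+∣-halves : ∀ p q {ε} → ∣ p ∣ ℚ.≤ ½ ℚ.* ε → ∣ q ∣ ℚ.≤ ½ ℚ.* ε → ∣ p ℚ.+ q ∣ ℚ.≤ ε
    ∣+∣-halves p q {ε} p≤ q≤ = begin
      ∣ p ℚ.+ q ∣          ≤⟨ ℚ.∣p+q∣≤∣p∣+∣q∣ p q ⟩
      ∣ p ∣ ℚ.+ ∣ q ∣      ≤⟨ ℚ.+-mono-≤ p≤ q≤ ⟩
      ½ ℚ.* ε ℚ.+ ½ ℚ.* ε  ≡⟨ half+half ε ⟩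
      ε                    ∎
      where open ℚ.≤-Reasoning

  ≈-trans : ∀ {x y z} → x ≈ y → y ≈ z → x ≈ z
  ≈-trans {x} {y} {z} (≃⇒≈ x≃y) (≃⇒≈ y≃z) = ≃⇒≈ λ ε 0<ε → zipEventually
    (λ n h₁ h₂ → subst (λ p → ∣ p ∣ ℚ.≤ ε)
      (solve 3 (λ a b c → (a :- b) :+ (b :- c) := a :- c) refl (seq x n) (seq y n) (seq z n))
      (∣+∣-halves (seq x n ℚ.- seq y n) (seq y n ℚ.- seq z n) h₁ h₂))
    (x≃y (½ ℚ.* ε) (half-positive 0<ε)) (y≃z (½ ℚ.* ε) (half-positive 0<ε))

  +-cong : ∀ {x y u v} → x ≈ y → u ≈ v → x + u ≈ y + v
  +-cong {x} {y} {u} {v} (≃⇒≈ x≃y) (≃⇒≈ u≃v) = ≃⇒≈ λ ε 0<ε → zipEventually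
    (λ n h₁ h₂ → subst (λ p → ∣ p ∣ ℚ.≤ ε)
      (solve 4 (λ a b c d → (a :- b) :+ (c :- d) := (a :+ c) :- (b :+ d)) refl
        (seq x n) (seq y n) (seq u n) (seq v n))
      (∣+∣-halves (seq x n ℚ.- seq y n) (seq u n ℚ.- seq v n) h₁ h₂))
    (x≃y (½ ℚ.* ε) (half-positive 0<ε)) (u≃v (½ ℚ.* ε) (half-positive 0<ε))

  -‿cong : ∀ {x y} → x ≈ y → - x ≈ - y
  -‿cong {x} {y} (≃⇒≈ x≃y) = ≃⇒≈ λ ε 0<ε → let N , h = x≃y ε 0<ε in N , λ n n≥ →
    subst (ℚ._≤ ε)
      (≡.trans (≡.sym (ℚ.∣-p∣≡∣p∣ (seq x n ℚ.- seq y n)))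
        (cong ∣_∣ (solve 2 (λ a b → :- (a :- b) := :- a :- :- b) refl (seq x n) (seq y n))))
      (h n n≥)

  -- Since xu - yv = x(u - v) + v(x - y), eventual bounds `r` on the absolute value of x and `s` on
  -- that of v turn a distance `δ` in both arguments into (r + s)δ. The choice of `δ` makes this
  -- equal to `ε`.
  *-cong : ∀ {x y u v} → x ≈ y → u ≈ v → x * u ≈ y * v
  *-cong {x} {y} {u} {v} (≃⇒≈ x≃y) (≃⇒≈ u≃v) = ≃⇒≈ λ ε 0<ε →
    let r , r>0 , x-bounded = eventually-bounded {seq x} (cauchy x)
        s , s>0 , v-bounded = eventually-bounded {seq v} (cauchy v)
        δ , 0<δ , [r+s]δ≡ε = divide (r ℚ.+ s) (ℚ.pos+pos⇒pos r {{r>0}} s {{s>0}}) ε 0<ε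
    in zipEventually
         (λ n (x≤r , v≤s) (x-y≤δ , u-v≤δ) → ℚ.≤-trans
           (product-close (seq x n) (seq u n) (seq y n) (seq v n) x≤r v≤s x-y≤δ u-v≤δ)
           (ℚ.≤-reflexive [r+s]δ≡ε))
         (zipEventually (λ _ → _,_) x-bounded v-bounded)
         (zipEventually (λ _ → _,_) (x≃y δ 0<δ) (u≃v δ 0<δ))

  ≈⇒≲ : ∀ {x y} → x ≈ y → x ≲ y
  ≈⇒≲ {x} {y} (≃⇒≈ x≃y) = ≤⇒≲ λ ε 0<ε → let N , h = x≃y ε 0<ε in N , λ n n≥ → begin
    seq x n                              ≡⟨ solve 2 (λ a b → a := b :+ (a :- b)) refl
                                              (seq x n) (seq y n) ⟩
    seq y n ℚ.+ (seq x n ℚ.- seq y n)    ≤⟨ ℚ.+-monoʳ-≤ (seq y n) (p≤∣p∣ (seq x n ℚ.- seq y n)) ⟩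
    seq y n ℚ.+ ∣ seq x n ℚ.- seq y n ∣  ≤⟨ ℚ.+-monoʳ-≤ (seq y n) (h n n≥) ⟩
    seq y n ℚ.+ ε                        ∎
    where open ℚ.≤-Reasoning

  pointwise-≲ : ∀ {x y} → (∀ n → seq x n ℚ.≤ seq y n) → x ≲ y
  pointwise-≲ {x} {y} h = ≤⇒≲ λ ε 0<ε → always λ n → ℚ.≤-trans (h n) (p≤p+ε (seq y n) 0<ε)

  ≲-trans : ∀ {x y z} → x ≲ y → y ≲ z → x ≲ z
  ≲-trans {x} {y} {z} (≤⇒≲ x≤y) (≤⇒≲ y≤z) = ≤⇒≲ λ ε 0<ε → zipEventually
    (λ n h₁ h₂ → begin
      seq x n                                ≤⟨ h₁ ⟩
      seq y n ℚ.+ ½ ℚ.* ε                    ≤⟨ ℚ.+-monoˡ-≤ (½ ℚ.* ε) h₂ ⟩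
      seq z n ℚ.+ ½ ℚ.* ε ℚ.+ ½ ℚ.* ε        ≡⟨ ℚ.+-assoc (seq z n) (½ ℚ.* ε) (½ ℚ.* ε) ⟩
      seq z n ℚ.+ (½ ℚ.* ε ℚ.+ ½ ℚ.* ε)      ≡⟨ cong (seq z n ℚ.+_) (half+half ε) ⟩
      seq z n ℚ.+ ε                          ∎)
    (x≤y (½ ℚ.* ε) (half-positive 0<ε)) (y≤z (½ ℚ.* ε) (half-positive 0<ε))
    where open ℚ.≤-Reasoning

  +-mono-≲ : ∀ {x y u v} → x ≲ y → u ≲ v → x + u ≲ y + v
  +-mono-≲ {x} {y} {u} {v} (≤⇒≲ x≤y) (≤⇒≲ u≤v) = ≤⇒≲ λ ε 0<ε → zipEventually
    (λ n h₁ h₂ → begin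
      seq x n ℚ.+ seq u n
        ≤⟨ ℚ.+-mono-≤ h₁ h₂ ⟩
      (seq y n ℚ.+ ½ ℚ.* ε) ℚ.+ (seq v n ℚ.+ ½ ℚ.* ε)
        ≡⟨ solve 3 (λ a b e → (a :+ con ½ :* e) :+ (b :+ con ½ :* e) := (a :+ b) :+ e) refl
             (seq y n) (seq v n) ε ⟩
      seq y n ℚ.+ seq v n ℚ.+ ε ∎)
    (x≤y (½ ℚ.* ε) (half-positive 0<ε)) (u≤v (½ ℚ.* ε) (half-positive 0<ε))
    where open ℚ.≤-Reasoning

  -- With x ≤ r, y ≤ s, x ≥ -δ and y ≥ -γ,
  -- xy + (rγ + (s + γ)δ) = (x + δ)(y + γ) + γ(r - x) + δ(s - y) ≥ 0,
  -- so γ is chosen with rγ = ε/2 and then δ with (s + γ)δ = ε/2.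
  *-nonNeg : ∀ {x y} → 0ℝ ≲ x → 0ℝ ≲ y → 0ℝ ≲ x * y
  *-nonNeg {x} {y} (≤⇒≲ 0≤x) (≤⇒≲ 0≤y) = ≤⇒≲ λ ε 0<ε →
    let r , r>0 , x-bounded = eventually-bounded {seq x} (cauchy x)
        s , s>0 , y-bounded = eventually-bounded {seq y} (cauchy y)
        γ , 0<γ , rγ≡ε/2 = divide r r>0 (½ ℚ.* ε) (half-positive 0<ε)
        δ , 0<δ , [s+γ]δ≡ε/2 = divide (s ℚ.+ γ) (ℚ.pos+pos⇒pos s {{s>0}} γ {{ℚ.positive 0<γ}})
                                 (½ ℚ.* ε) (half-positive 0<ε)
    in zipEventually
         (λ n (x≤r , y≤s) (0≤x+δ , 0≤y+γ) → begin
           0ℚ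
             ≤⟨ ℚ.+-mono-≤ (ℚ.+-mono-≤
                  (0≤p*q 0≤x+δ 0≤y+γ)
                  (0≤p*q (ℚ.<⇒≤ 0<γ) (0≤q-p (ℚ.≤-trans (p≤∣p∣ (seq x n)) x≤r))))
                  (0≤p*q (ℚ.<⇒≤ 0<δ) (0≤q-p (ℚ.≤-trans (p≤∣p∣ (seq y n)) y≤s))) ⟩
           (seq x n ℚ.+ δ) ℚ.* (seq y n ℚ.+ γ) ℚ.+ γ ℚ.* (r ℚ.- seq x n) ℚ.+ δ ℚ.* (s ℚ.- seq y n)
             ≡⟨ solve 6 (λ a b r s γ δ →
                  (a :+ δ) :* (b :+ γ) :+ γ :* (r :- a) :+ δ :* (s :- b)
                    := a :* b :+ (r :* γ :+ (s :+ γ) :* δ)) refl (seq x n) (seq y n) r s γ δ ⟩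
           seq x n ℚ.* seq y n ℚ.+ (r ℚ.* γ ℚ.+ (s ℚ.+ γ) ℚ.* δ)
             ≡⟨ cong (seq x n ℚ.* seq y n ℚ.+_)
                  (≡.trans (≡.cong₂ ℚ._+_ rγ≡ε/2 [s+γ]δ≡ε/2) (half+half ε)) ⟩
           seq x n ℚ.* seq y n ℚ.+ ε ∎)
         (zipEventually (λ _ → _,_) x-bounded y-bounded)
         (zipEventually (λ _ → _,_) (0≤x δ 0<δ) (0≤y γ 0<γ))
    where open ℚ.≤-Reasoning

≈-refl : ∀ {x} → x ≈ x
≈-refl = pointwise-≈ λ _ → refl

-- The reals as a preordered commutative ring.

ℝ-isCommutativeRing : IsCommutativeRing _≈_ _+_ _*_ -_ 0ℝ 1ℝ
ℝ-isCommutativeRing = record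
  { isRing = record
    { +-isAbelianGroup = record
      { isGroup = record
        { isMonoid = record
          { isSemigroup = record
            { isMagma = record
              { isEquivalence = record { refl = ≈-refl ; sym = ≈-sym ; trans = ≈-trans }
              ; ∙-cong = +-cong
              }
            ; assoc = λ x y z → pointwise-≈ λ n → ℚ.+-assoc (seq x n) (seq y n) (seq z n)
            }
          ; identity = (λ x → pointwise-≈ λ n → ℚ.+-identityˡ (seq x n))
                     , (λ x → pointwise-≈ λ n → ℚ.+-identityʳ (seq x n))
          }
        ; inverse = (λ x → pointwise-≈ λ n → ℚ.+-inverseˡ (seq x n))
                  , (λ x → pointwise-≈ λ n → ℚ.+-inverseʳ (seq x n))
        ; ⁻¹-cong = -‿cong
        }
      ; comm = λ x y → pointwise-≈ λ n → ℚ.+-comm (seq x n) (seq y n)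
      }
    ; *-cong = *-cong
    ; *-assoc = λ x y z → pointwise-≈ λ n → ℚ.*-assoc (seq x n) (seq y n) (seq z n)
    ; *-identity = (λ x → pointwise-≈ λ n → ℚ.*-identityˡ (seq x n))
                 , (λ x → pointwise-≈ λ n → ℚ.*-identityʳ (seq x n))
    ; distrib = (λ x y z → pointwise-≈ λ n → ℚ.*-distribˡ-+ (seq x n) (seq y n) (seq z n))
              , (λ x y z → pointwise-≈ λ n → ℚ.*-distribʳ-+ (seq x n) (seq y n) (seq z n))
    }
  ; *-comm = λ x y → pointwise-≈ λ n → ℚ.*-comm (seq x n) (seq y n)
  }

ℝ-commutativeRing : CommutativeRing 0ℓ 0ℓ
ℝ-commutativeRing = record { isCommutativeRing = ℝ-isCommutativeRing }

≲-preorder : Preorder 0ℓ 0ℓ 0ℓ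
≲-preorder = record
  { _≈_ = _≈_
  ; _≲_ = _≲_
  ; isPreorder = record
    { isEquivalence = CommutativeRing.isEquivalence ℝ-commutativeRing
    ; reflexive = ≈⇒≲
    ; trans = ≲-trans
    }
  }

open CommutativeRing ℝ-commutativeRing
  using (setoid; semiring; +-identityˡ; +-identityʳ; -‿inverseʳ; *-assoc; *-comm; *-identityˡ;
         distribˡ; distribʳ; zeroˡ; zeroʳ)
open SemiringSum semiring
  using (sum-cong-≋; sum-replicate-zero; ∑-distrib-+; *-distribˡ-sum)

module ≈-Reasoning = SetoidReasoning setoid
module ≲-Reasoning = PreorderReasoning ≲-preorder

≲-refl : ∀ {x} → x ≲ x
≲-refl = ≈⇒≲ ≈-refl

0≲y-x : ∀ {x y} → x ≲ y → 0ℝ ≲ y - x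
0≲y-x {x} {y} x≲y = begin
  0ℝ     ≈⟨ pointwise-≈ (λ n → ≡.sym (ℚ.+-inverseʳ (seq x n))) ⟩
  x - x  ≲⟨ +-mono-≲ x≲y ≲-refl ⟩
  y - x  ∎
  where open ≲-Reasoning

-- The product of x and z - y is nonnegative; adding xy to it gives xz.
*-monoˡ-≲ : ∀ x {y z} → 0ℝ ≲ x → y ≲ z → x * y ≲ x * z
*-monoˡ-≲ x {y} {z} 0≲x y≲z = begin
  x * y                  ≈⟨ pointwise-≈ (λ n → ≡.sym (ℚ.+-identityˡ (seq x n ℚ.* seq y n))) ⟩
  0ℝ + x * y             ≲⟨ +-mono-≲ (*-nonNeg 0≲x (0≲y-x y≲z)) ≲-refl ⟩
  x * (z - y) + x * y    ≈⟨ pointwise-≈ (λ n →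
                              solve 3 (λ x y z → x :* (z :- y) :+ x :* y := x :* z) refl
                                (seq x n) (seq y n) (seq z n)) ⟩
  x * z                  ∎
  where open ≲-Reasoning

*-monoʳ-≲ : ∀ x {y z} → 0ℝ ≲ x → y ≲ z → y * x ≲ z * x
*-monoʳ-≲ x {y} {z} 0≲x y≲z = begin
  y * x  ≈⟨ *-comm y x ⟩
  x * y  ≲⟨ *-monoˡ-≲ x 0≲x y≲z ⟩
  x * z  ≈⟨ *-comm x z ⟩
  z * x  ∎
  where open ≲-Reasoning

-- The right side exceeds the left by the square of p - 1/2, which is nonnegative at every index of
-- the sequence.
p[1-p]≲¼ : ∀ p → p * (1ℝ - p) ≲ ½ℝ * ½ℝ
p[1-p]≲¼ p = pointwise-≲ λ n → let a = seq p n in begin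
  a ℚ.* (1ℚ ℚ.- a)
    ≡⟨ ℚ.+-identityʳ (a ℚ.* (1ℚ ℚ.- a)) ⟨
  a ℚ.* (1ℚ ℚ.- a) ℚ.+ 0ℚ
    ≤⟨ ℚ.+-monoʳ-≤ (a ℚ.* (1ℚ ℚ.- a)) (0≤p*p (a ℚ.- ½)) ⟩
  a ℚ.* (1ℚ ℚ.- a) ℚ.+ (a ℚ.- ½) ℚ.* (a ℚ.- ½)
    ≡⟨ solve 1 (λ a → a :* (con 1ℚ :- a) :+ (a :- con ½) :* (a :- con ½) := con ½ :* con ½)
         refl a ⟩
  ½ ℚ.* ½ ∎
  where open ℚ.≤-Reasoning

-- Finite sums over buyers and over sets of buyers.

*-congˡ : ∀ x {y z} → y ≈ z → x * y ≈ x * z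
*-congˡ x y≈z = *-cong (≈-refl {x}) y≈z

*-congʳ : ∀ x {y z} → y ≈ z → y * x ≈ z * x
*-congʳ x y≈z = *-cong y≈z (≈-refl {x})

∑-cong : ∀ {n} {f g : Fin n → ℝ} → (∀ i → f i ≈ g i) → ∑ f ≈ ∑ g
∑-cong = sum-cong-≋

*-distribˡ-∑∑ : ∀ {m n} c (f : Fin m → Fin n → ℝ) →
  c * ∑ (λ i → ∑ (λ j → f i j)) ≈ ∑ (λ i → ∑ (λ j → c * f i j))
*-distribˡ-∑∑ c f = ≈-trans (*-distribˡ-sum c (λ i → ∑ (f i)))
  (∑-cong λ i → *-distribˡ-sum c (f i))

∑-mono-≲ : ∀ {n} {f g : Fin n → ℝ} → (∀ i → f i ≲ g i) → ∑ f ≲ ∑ g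
∑-mono-≲ {zero}  h = ≲-refl
∑-mono-≲ {suc n} h = +-mono-≲ (h zero) (∑-mono-≲ (λ i → h (suc i)))

∑-nonNeg : ∀ {n} {f : Fin n → ℝ} → (∀ i → 0ℝ ≲ f i) → 0ℝ ≲ ∑ f
∑-nonNeg {n} {f} h = begin
  0ℝ                ≈⟨ sum-replicate-zero n ⟨
  ∑ {n} (λ _ → 0ℝ)  ≲⟨ ∑-mono-≲ h ⟩
  ∑ f               ∎
  where open ≲-Reasoning

∑⊆-cong : ∀ {n} {f g : Subset n → ℝ} → (∀ A → f A ≈ g A) → ∑⊆ f ≈ ∑⊆ g
∑⊆-cong {zero}  h = h []
∑⊆-cong {suc n} h = +-cong (∑⊆-cong (λ A → h (inside ∷ A))) (∑⊆-cong (λ A → h (outside ∷ A)))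

*-distribˡ-∑⊆ : ∀ {n} x (f : Subset n → ℝ) → x * ∑⊆ f ≈ ∑⊆ (λ A → x * f A)
*-distribˡ-∑⊆ {zero}  x f = ≈-refl
*-distribˡ-∑⊆ {suc n} x f = ≈-trans
  (distribˡ x (∑⊆ (λ A → f (inside ∷ A))) (∑⊆ (λ A → f (outside ∷ A))))
  (+-cong (*-distribˡ-∑⊆ x (λ A → f (inside ∷ A))) (*-distribˡ-∑⊆ x (λ A → f (outside ∷ A))))

-- Expectation over a random set of buyers.

module _ (q : ℝ) where

  -- The expectation is defined by conditioning on the membership of the first buyer, not as a
  -- weighted sum over all sets. Linearity, marginals and independence then become inductions on the
  -- number of buyers.
  𝔼 : ∀ {n} → (Subset n → ℝ) → ℝ
  𝔼 {zero}  f = f []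
  𝔼 {suc n} f = q * 𝔼 (λ A → f (inside ∷ A)) + (1ℝ - q) * 𝔼 (λ A → f (outside ∷ A))

  probability : ∀ {n} → Subset n → ℝ
  probability A = ∏ λ i → if does (i ∈? A) then q else 1ℝ - q

  -- On each half of `∑⊆` the product of probabilities computes to a fixed first factor, `q` or
  -- `1ℝ - q`, times the probability of the remaining set. `condition` pulls that factor out of the
  -- sum.
  ∑⊆-probability : ∀ {n} (f : Subset n → ℝ) → ∑⊆ (λ A → probability A * f A) ≈ 𝔼 f
  ∑⊆-probability {zero}  f = *-identityˡ (f [])
  ∑⊆-probability {suc n} f =
    +-cong (condition q (λ A → f (inside ∷ A))) (condition (1ℝ - q) (λ A → f (outside ∷ A)))
    where
    open ≈-Reasoning
    condition : ∀ x g → ∑⊆ (λ A → x * probability A * g A) ≈ x * 𝔼 g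
    condition x g = begin
      ∑⊆ (λ A → x * probability A * g A)    ≈⟨ ∑⊆-cong (λ A → *-assoc x (probability A) (g A)) ⟩
      ∑⊆ (λ A → x * (probability A * g A))  ≈⟨ *-distribˡ-∑⊆ x (λ A → probability A * g A) ⟨
      x * ∑⊆ (λ A → probability A * g A)    ≈⟨ *-congˡ x (∑⊆-probability g) ⟩
      x * 𝔼 g                               ∎

  𝔼-cong : ∀ {n} {f g : Subset n → ℝ} → (∀ A → f A ≈ g A) → 𝔼 f ≈ 𝔼 g
  𝔼-cong {zero}  h = h []
  𝔼-cong {suc n} h = +-cong
    (*-congˡ q (𝔼-cong (λ A → h (inside ∷ A))))
    (*-congˡ (1ℝ - q) (𝔼-cong (λ A → h (outside ∷ A))))

  -- The two weights add up to 1. This removes every buyer on whose membership the integrand does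
  -- not depend.
  average-const : ∀ c → q * c + (1ℝ - q) * c ≈ c
  average-const c = pointwise-≈ λ n →
    solve 2 (λ q c → q :* c :+ (con 1ℚ :- q) :* c := c) refl (seq q n) (seq c n)

  𝔼-const : ∀ {n} c → 𝔼 {n} (λ _ → c) ≈ c
  𝔼-const {zero}  c = ≈-refl
  𝔼-const {suc n} c = ≈-trans
    (+-cong (*-congˡ q (𝔼-const {n} c)) (*-congˡ (1ℝ - q) (𝔼-const {n} c))) (average-const c)

  𝔼-distrib-+ : ∀ {n} (f g : Subset n → ℝ) → 𝔼 (λ A → f A + g A) ≈ 𝔼 f + 𝔼 g
  𝔼-distrib-+ {zero}  f g = ≈-refl
  𝔼-distrib-+ {suc n} f g = ≈-trans
    (+-cong (*-congˡ q (𝔼-distrib-+ (λ A → f (inside ∷ A)) (λ A → g (inside ∷ A))))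
            (*-congˡ (1ℝ - q) (𝔼-distrib-+ (λ A → f (outside ∷ A)) (λ A → g (outside ∷ A)))))
    (interchange q (1ℝ - q)
      (𝔼 (λ A → f (inside ∷ A))) (𝔼 (λ A → g (inside ∷ A)))
      (𝔼 (λ A → f (outside ∷ A))) (𝔼 (λ A → g (outside ∷ A))))
    where
    interchange : ∀ q r a b c d → q * (a + b) + r * (c + d) ≈ (q * a + r * c) + (q * b + r * d)
    interchange q r a b c d = pointwise-≈ λ n → solve 6 (λ q r a b c d →
      q :* (a :+ b) :+ r :* (c :+ d) := (q :* a :+ r :* c) :+ (q :* b :+ r :* d)) refl
      (seq q n) (seq r n) (seq a n) (seq b n) (seq c n) (seq d n)

  𝔼-*ˡ : ∀ {n} x (f : Subset n → ℝ) → 𝔼 (λ A → x * f A) ≈ x * 𝔼 f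
  𝔼-*ˡ {zero}  x f = ≈-refl
  𝔼-*ˡ {suc n} x f = ≈-trans
    (+-cong (*-congˡ q (𝔼-*ˡ x (λ A → f (inside ∷ A))))
            (*-congˡ (1ℝ - q) (𝔼-*ˡ x (λ A → f (outside ∷ A)))))
    (factor q (1ℝ - q) (𝔼 (λ A → f (inside ∷ A))) (𝔼 (λ A → f (outside ∷ A))))
    where
    factor : ∀ q r a b → q * (x * a) + r * (x * b) ≈ x * (q * a + r * b)
    factor q r a b = pointwise-≈ λ n → solve 5 (λ x q r a b →
      q :* (x :* a) :+ r :* (x :* b) := x :* (q :* a :+ r :* b)) refl
      (seq x n) (seq q n) (seq r n) (seq a n) (seq b n)

  𝔼-*ʳ : ∀ {n} x (f : Subset n → ℝ) → 𝔼 (λ A → f A * x) ≈ 𝔼 f * x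
  𝔼-*ʳ x f = begin
    𝔼 (λ A → f A * x)  ≈⟨ 𝔼-cong (λ A → *-comm (f A) x) ⟩
    𝔼 (λ A → x * f A)  ≈⟨ 𝔼-*ˡ x f ⟩
    x * 𝔼 f            ≈⟨ *-comm x (𝔼 f) ⟩
    𝔼 f * x            ∎
    where open ≈-Reasoning

  𝔼-∑ : ∀ {m n} (f : Fin m → Subset n → ℝ) → 𝔼 (λ A → ∑ (λ i → f i A)) ≈ ∑ (λ i → 𝔼 (f i))
  𝔼-∑ {zero}  {n} f = 𝔼-const {n} 0ℝ
  𝔼-∑ {suc m} f = ≈-trans
    (𝔼-distrib-+ (f zero) (λ A → ∑ (λ i → f (suc i) A)))
    (+-cong ≈-refl (𝔼-∑ (λ i → f (suc i))))

  bernoulli : (Bool → ℝ) → ℝ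
  bernoulli χ = q * χ true + (1ℝ - q) * χ false

  -- All buyers other than `i` average out: those before `i` by `average-const`, those after it by
  -- `𝔼-const`.
  𝔼-∈ : ∀ {n} (i : Fin n) χ → 𝔼 (λ A → χ (does (i ∈? A))) ≈ bernoulli χ
  𝔼-∈ {suc n} zero χ = +-cong
    (*-congˡ q (𝔼-const {n} (χ true))) (*-congˡ (1ℝ - q) (𝔼-const {n} (χ false)))
  𝔼-∈ {suc n} (suc i) χ = ≈-trans
    (+-cong (*-congˡ q (𝔼-∈ i χ)) (*-congˡ (1ℝ - q) (𝔼-∈ i χ)))
    (average-const (bernoulli χ))

  -- Once the membership of the first buyer is fixed, the value of `χ` is a constant factor, and
  -- what remains is the marginal of `j`.
  𝔼-zero-suc : ∀ {n} (j : Fin n) χ ψ →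
    𝔼 (λ A → χ (does (zero ∈? A)) * ψ (does (suc j ∈? A))) ≈ bernoulli χ * bernoulli ψ
  𝔼-zero-suc j χ ψ = ≈-trans
    (+-cong (branch q (χ true)) (branch (1ℝ - q) (χ false)))
    (≈-sym (distribʳ (bernoulli ψ) (q * χ true) ((1ℝ - q) * χ false)))
    where
    open ≈-Reasoning
    branch : ∀ x c → x * 𝔼 (λ A → c * ψ (does (j ∈? A))) ≈ x * c * bernoulli ψ
    branch x c = begin
      x * 𝔼 (λ A → c * ψ (does (j ∈? A)))    ≈⟨ *-congˡ x (𝔼-*ˡ c (λ A → ψ (does (j ∈? A)))) ⟩
      x * (c * 𝔼 (λ A → ψ (does (j ∈? A))))  ≈⟨ *-congˡ x (*-congˡ c (𝔼-∈ j ψ)) ⟩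
      x * (c * bernoulli ψ)                  ≈⟨ *-assoc x c (bernoulli ψ) ⟨
      x * c * bernoulli ψ                    ∎

  -- Buyers before both `i` and `j` average out. As the two indices differ, exactly one of them is
  -- reached first; conditioning on it is `𝔼-zero-suc`, up to the order of the factors.
  𝔼-independent : ∀ {n} (i j : Fin n) χ ψ → i ≢ j →
    𝔼 (λ A → χ (does (i ∈? A)) * ψ (does (j ∈? A))) ≈ bernoulli χ * bernoulli ψ
  𝔼-independent zero    zero    χ ψ i≢j = contradiction refl i≢j
  𝔼-independent zero    (suc j) χ ψ i≢j = 𝔼-zero-suc j χ ψ
  𝔼-independent (suc i) zero    χ ψ i≢j = begin
    𝔼 (λ A → χ (does (suc i ∈? A)) * ψ (does (zero ∈? A)))
      ≈⟨ 𝔼-cong (λ A → *-comm (χ (does (suc i ∈? A))) (ψ (does (zero ∈? A)))) ⟩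
    𝔼 (λ A → ψ (does (zero ∈? A)) * χ (does (suc i ∈? A)))
      ≈⟨ 𝔼-zero-suc i ψ χ ⟩
    bernoulli ψ * bernoulli χ
      ≈⟨ *-comm (bernoulli ψ) (bernoulli χ) ⟩
    bernoulli χ * bernoulli ψ ∎
    where open ≈-Reasoning
  𝔼-independent (suc i) (suc j) χ ψ i≢j = ≈-trans
    (+-cong (*-congˡ q IH) (*-congˡ (1ℝ - q) IH)) (average-const (bernoulli χ * bernoulli ψ))
    where
    IH : 𝔼 (λ A → χ (does (i ∈? A)) * ψ (does (j ∈? A))) ≈ bernoulli χ * bernoulli ψ
    IH = 𝔼-independent i j χ ψ (λ i≡j → i≢j (cong suc i≡j))

-- Expected revenue of the IE strategy.

module _ {n : ℕ} (G : DirectedSocialNetwork n) where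
  open DirectedSocialNetwork G

  totalWeight : ℝ
  totalWeight = ∑ λ i → ∑ λ j → w j i

  module _ (q p : ℝ) where

    -- An edge from j to i earns only if i is outside the set `A`, which `χ` records. It then counts
    -- fully if j received the product for free, and otherwise with p/2: j buys with probability p
    -- and precedes i half of the time. `ψ` is this second factor.
    χ ψ : Bool → ℝ
    χ b = if b then 0ℝ else 1ℝ
    ψ b = if b then 1ℝ else ½ℝ * p

    -- This merges the two conditional sums of `revenueIE` into one. The second of them skips j = i
    -- while the merged sum keeps it; the added term vanishes because there are no loops.
    contribution : ∀ b {i j} (j≟i : Dec (j ≡ i)) →
      (if b then w j i else 0ℝ) + (if not b ∧ not (does j≟i) then ½ℝ * (p * w j i) else 0ℝ)
        ≈ ψ b * w j i
    contribution true  {i} {j} _ = pointwise-≈ λ n →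
      solve 1 (λ w → w :+ con 0ℚ := con 1ℚ :* w) refl (seq (w j i) n)
    contribution false {i} {j} (no _) = pointwise-≈ λ n →
      solve 2 (λ p w → con 0ℚ :+ con ½ :* (p :* w) := con ½ :* p :* w) refl
        (seq p n) (seq (w j i) n)
    contribution false {i} (yes refl) = begin
      0ℝ + 0ℝ           ≈⟨ +-identityˡ 0ℝ ⟩
      0ℝ                ≈⟨ zeroʳ (½ℝ * p) ⟨
      ½ℝ * p * 0ℝ       ≈⟨ *-congˡ (½ℝ * p) (≃⇒≈ (w-noLoop i)) ⟨
      ½ℝ * p * w i i    ∎
      where open ≈-Reasoning

    unless : ∀ b {x} → (if not b then x else 0ℝ) ≈ χ b * x
    unless true  {x} = ≈-sym (zeroˡ x)
    unless false {x} = ≈-sym (*-identityˡ x)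

    -- Each summand becomes a function of the membership of i times a function of the membership of
    -- j, the form to which independence applies.
    revenueIE-as-sum : ∀ A → revenueIE G A p ≈
      p * (1ℝ - p) * ∑ λ i → ∑ λ j → χ (does (i ∈? A)) * ψ (does (j ∈? A)) * w j i
    revenueIE-as-sum A = *-congˡ (p * (1ℝ - p)) (∑-cong row)
      where
      open ≈-Reasoning
      -- The summand of the outer `∑[_]` with its test unfolded: `does` of `¬?` and `_×-dec_`
      -- computes to `not` and `_∧_`, as `unless` and `contribution` expect.
      row : ∀ i →
        (if not (does (i ∈? A))
         then ∑ (λ j → if does (j ∈? A) then w j i else 0ℝ)
            + ∑ (λ j → if does (¬? (j ∈? A) ×-dec ¬? (j Fin.≟ i)) then ½ℝ * (p * w j i) else 0ℝ)
         else 0ℝ)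
          ≈ ∑ λ j → χ (does (i ∈? A)) * ψ (does (j ∈? A)) * w j i
      row i = begin
        (if not b then ∑ f + ∑ g else 0ℝ)  ≈⟨ unless b ⟩
        χ b * (∑ f + ∑ g)                  ≈⟨ *-congˡ (χ b) (∑-distrib-+ f g) ⟨
        χ b * ∑ (λ j → f j + g j)          ≈⟨ *-congˡ (χ b) (∑-cong λ j →
                                                contribution (does (j ∈? A)) (j Fin.≟ i)) ⟩
        χ b * ∑ h                          ≈⟨ *-distribˡ-sum (χ b) h ⟩
        ∑ (λ j → χ b * h j)                ≈⟨ ∑-cong (λ j →
                                                *-assoc (χ b) (ψ (does (j ∈? A))) (w j i)) ⟨
        ∑ (λ j → χ b * ψ (does (j ∈? A)) * w j i) ∎
        where
        b : Bool
        b = does (i ∈? A)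
        f g h : Fin n → ℝ
        f j = if does (j ∈? A) then w j i else 0ℝ
        g j = if does (¬? (j ∈? A) ×-dec ¬? (j Fin.≟ i)) then ½ℝ * (p * w j i) else 0ℝ
        h j = ψ (does (j ∈? A)) * w j i

    𝔼-edge : ∀ i j → 𝔼 q (λ A → χ (does (i ∈? A)) * ψ (does (j ∈? A)) * w j i)
      ≈ bernoulli q χ * bernoulli q ψ * w j i
    𝔼-edge i j with i Fin.≟ j
    ... | no i≢j = ≈-trans
      (𝔼-*ʳ q (w j i) (λ A → χ (does (i ∈? A)) * ψ (does (j ∈? A))))
      (*-congʳ (w j i) (𝔼-independent q i j χ ψ i≢j))
    ... | yes refl = ≈-trans
      (𝔼-*ʳ q (w i i) χψ)
      (≈-trans (loop (𝔼 q χψ)) (≈-sym (loop (bernoulli q χ * bernoulli q ψ))))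
      where
      χψ : Subset n → ℝ
      χψ A = χ (does (i ∈? A)) * ψ (does (i ∈? A))
      loop : ∀ x → x * w i i ≈ 0ℝ
      loop x = ≈-trans (*-congˡ x (≃⇒≈ (w-noLoop i))) (zeroʳ x)

    -- Linearity moves the expectation to the single edges. The coefficient found there is the same
    -- for all edges, so only the total weight remains.
    expectedRevenueIE-≈ : expectedRevenueIE G q p ≈
      p * (1ℝ - p) * (bernoulli q χ * bernoulli q ψ * totalWeight)
    expectedRevenueIE-≈ = begin
      expectedRevenueIE G q p
        ≈⟨ ∑⊆-probability q (λ A → revenueIE G A p) ⟩
      𝔼 q (λ A → revenueIE G A p)
        ≈⟨ 𝔼-cong q revenueIE-as-sum ⟩
      𝔼 q (λ A → p * (1ℝ - p) * ∑ λ i → ∑ λ j → e i j A)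
        ≈⟨ 𝔼-*ˡ q (p * (1ℝ - p)) (λ A → ∑ λ i → ∑ λ j → e i j A) ⟩
      p * (1ℝ - p) * 𝔼 q (λ A → ∑ λ i → ∑ λ j → e i j A)
        ≈⟨ *-congˡ (p * (1ℝ - p)) (𝔼-∑ q (λ i A → ∑ λ j → e i j A)) ⟩
      p * (1ℝ - p) * ∑ (λ i → 𝔼 q (λ A → ∑ λ j → e i j A))
        ≈⟨ *-congˡ (p * (1ℝ - p)) (∑-cong λ i →
             ≈-trans (𝔼-∑ q (e i)) (∑-cong (𝔼-edge i))) ⟩
      p * (1ℝ - p) * ∑ (λ i → ∑ (λ j → bernoulli q χ * bernoulli q ψ * w j i))
        ≈⟨ *-congˡ (p * (1ℝ - p)) (*-distribˡ-∑∑ (bernoulli q χ * bernoulli q ψ) (λ i j → w j i)) ⟨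
      p * (1ℝ - p) * (bernoulli q χ * bernoulli q ψ * totalWeight) ∎
      where
      open ≈-Reasoning
      e : Fin n → Fin n → Subset n → ℝ
      e i j A = χ (does (i ∈? A)) * ψ (does (j ∈? A)) * w j i

  -- Upper bound for an arbitrary marketing strategy.

  revenue-≲ : ∀ σ → revenue G σ ≲ ½ℝ * ½ℝ * totalWeight
  revenue-≲ σ = begin
    ∑ (λ i → p i * (1ℝ - p i) * ∑ (s i))
      -- Replacing the price factor by 1/4 requires the inner sum to be nonnegative. The next step
      -- raises each `p j` to 1 and admits the pairs in the wrong order.
      ≲⟨ ∑-mono-≲ (λ i → *-monoʳ-≲ (∑ (s i)) (∑-nonNeg (0≲s i)) (p[1-p]≲¼ (p i))) ⟩
    ∑ (λ i → ½ℝ * ½ℝ * ∑ (s i))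
      ≲⟨ ∑-mono-≲ (λ i → *-monoˡ-≲ (½ℝ * ½ℝ) 0≲¼ (∑-mono-≲ (s≲w i))) ⟩
    ∑ (λ i → ½ℝ * ½ℝ * ∑ (λ j → w j i))
      ≈⟨ *-distribˡ-sum (½ℝ * ½ℝ) (λ i → ∑ (λ j → w j i)) ⟨
    ½ℝ * ½ℝ * totalWeight ∎
    where
    open ≲-Reasoning
    open MarketingStrategy σ

    s : Fin n → Fin n → ℝ
    s i j = if does ((π ⟨$⟩ʳ j) Fin.<? (π ⟨$⟩ʳ i)) then p j * w j i else 0ℝ

    0≲w : ∀ i j → 0ℝ ≲ w j i
    0≲w i j = ≤⇒≲ (w-nonNeg j i)

    0≲½ : 0ℝ ≲ ½ℝ
    0≲½ = pointwise-≲ λ _ → ℚ.nonNegative⁻¹ ½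

    0≲¼ : 0ℝ ≲ ½ℝ * ½ℝ
    0≲¼ = *-nonNeg 0≲½ 0≲½

    0≲s : ∀ i j → 0ℝ ≲ s i j
    0≲s i j with does ((π ⟨$⟩ʳ j) Fin.<? (π ⟨$⟩ʳ i))
    ... | true  = *-nonNeg (≲-trans 0≲½ (≤⇒≲ (½≤p j))) (0≲w i j)
    ... | false = ≲-refl

    s≲w : ∀ i j → s i j ≲ w j i
    s≲w i j with does ((π ⟨$⟩ʳ j) Fin.<? (π ⟨$⟩ʳ i))
    ... | false = 0≲w i j
    ... | true  = begin
      p j * w j i  ≲⟨ *-monoʳ-≲ (w j i) (0≲w i j) (≤⇒≲ (p≤1 j)) ⟩
      1ℝ * w j i   ≈⟨ *-identityˡ (w j i) ⟩
      w j i        ∎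

-- Arithmetic of `√2` and the approximation ratio.

√2≲2 : √2 ≲ 2ℝ
√2≲2 = pointwise-≲ λ n → ℚ.+-monoʳ-≤ 1ℚ {√2-1-seq n} {1ℚ}
  (ℚ.≤-trans (proj₂ (√2-1-bounds n)) (ℚ.≤ᵇ⇒≤ {½} {1ℚ} _))

1≲√2 : 1ℝ ≲ √2
1≲√2 = pointwise-≲ λ n → ℚ.+-monoʳ-≤ 1ℚ {0ℚ} {√2-1-seq n} (proj₁ (√2-1-bounds n))

-- The terms of `√2` are rational, so none of them squares to 2. A termwise identity must therefore
-- carry a multiple of this difference, which vanishes only as a real number.
√2*√2-2≈0 : √2 * √2 - 2ℝ ≈ 0ℝ
√2*√2-2≈0 = ≈-trans (+-cong (≃⇒≈ {√2 * √2} {2ℝ} √2*√2≃2) (≈-refl { - 2ℝ})) (-‿inverseʳ 2ℝ)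

-- With s = √2, the right-hand side is p(1-p)(s/4 - s/8 (s² - 2))x.
ratio-identity : ∀ x →
  √2 * (2ℝ - √2) * (√2 - 1ℝ) * (½ℝ * ½ℝ * x) ≈
  let q = 1ℝ - √2 * ½ℝ
      p = 2ℝ - √2
  in p * (1ℝ - p) * ((q * 0ℝ + (1ℝ - q) * 1ℝ) * (q * 1ℝ + (1ℝ - q) * (½ℝ * p)) * x)
ratio-identity x = begin
  √2 * (2ℝ - √2) * (√2 - 1ℝ) * (½ℝ * ½ℝ * x)
    ≈⟨ pointwise-≈ (λ n → solve 2 (λ s x →
         let 2′ = con (1ℚ ℚ.+ 1ℚ)
             q = con 1ℚ :- s :* con ½
             p = 2′ :- s
         in s :* p :* (s :- con 1ℚ) :* (con ½ :* con ½ :* x)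
              := p :* (con 1ℚ :- p) :* ((q :* con 0ℚ :+ (con 1ℚ :- q) :* con 1ℚ)
                   :* (q :* con 1ℚ :+ (con 1ℚ :- q) :* (con ½ :* p)) :* x)
                 :+ p :* (con 1ℚ :- p) :* (con ½ :* con ½ :* con ½ :* s) :* x :* (s :* s :- 2′))
         refl (seq √2 n) (seq x n)) ⟩
  rhs + d * (√2 * √2 - 2ℝ)
    ≈⟨ +-cong ≈-refl (≈-trans (*-congˡ d √2*√2-2≈0) (zeroʳ d)) ⟩
  rhs + 0ℝ
    ≈⟨ +-identityʳ rhs ⟩
  rhs ∎
  where
  open ≈-Reasoning
  q p rhs d : ℝ
  q = 1ℝ - √2 * ½ℝ
  p = 2ℝ - √2
  rhs = p * (1ℝ - p) * ((q * 0ℝ + (1ℝ - q) * 1ℝ) * (q * 1ℝ + (1ℝ - q) * (½ℝ * p)) * x)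
  d = p * (1ℝ - p) * (½ℝ * ½ℝ * ½ℝ * √2) * x

0≲ratio : 0ℝ ≲ √2 * (2ℝ - √2) * (√2 - 1ℝ)
0≲ratio = *-nonNeg (*-nonNeg (≤⇒≲ {0ℝ} {√2} 0≤√2) (0≲y-x {√2} {2ℝ} √2≲2)) (0≲y-x {1ℝ} {√2} 1≲√2)

proposition2 : (n : ℕ) (G : DirectedSocialNetwork n) →
    let ratio = √2 * (2ℝ - √2) * (√2 - 1ℝ)
        E     = expectedRevenueIE G (1ℝ - √2 * ½ℝ) (2ℝ - √2)
    in (∀ M → IsMaximumRevenue G M → ratio * M ≤ E)
       × (∀ σ → ratio * revenue G σ ≤ E)
proposition2 n G =
  -- The maximum is attained at some `σ`, so this claim is the bound for that strategy.
  (λ { M (_ , σ , R≃M) → ≲⇒≤ (≲-trans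
         (≈⇒≲ (*-congˡ ratio (≈-sym (≃⇒≈ {revenue G σ} {M} R≃M)))) (bound σ)) }) ,
  (λ σ → ≲⇒≤ (bound σ))
  where
  open ≲-Reasoning

  ratio E : ℝ
  ratio = √2 * (2ℝ - √2) * (√2 - 1ℝ)
  E = expectedRevenueIE G (1ℝ - √2 * ½ℝ) (2ℝ - √2)

  bound : ∀ σ → ratio * revenue G σ ≲ E
  bound σ = begin
    ratio * revenue G σ                    ≲⟨ *-monoˡ-≲ ratio 0≲ratio (revenue-≲ G σ) ⟩
    ratio * (½ℝ * ½ℝ * totalWeight G)      ≈⟨ ratio-identity (totalWeight G) ⟩
    -- `bernoulli` at `χ` and at `ψ` unfolds to the two linear factors in `ratio-identity`, so both
    -- neighbours determine the same omitted term.
    _                                      ≈⟨ expectedRevenueIE-≈ G (1ℝ - √2 * ½ℝ) (2ℝ - √2) ⟨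
    E                                      ∎
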